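{- The icosahedral graph (the $1$-skeleton of the regular icosahedron, a $5$-regular graph on $12$ vertices) is diagonal, i.e. $\mathrm{MH}_{k,l}(G)\neq 0$ only if $k=l$.
   Context: For a finite simple undirected connected graph $G$, $d$ denotes the shortest-path metric on $V(G)$. For a tuple of vertices $(x_0,\ldots,x_k)$ put $\ell(x_0,\ldots,x_k)=\sum_{i=0}^{k-1} d(x_i,x_{i+1})$. The magnitude chain complex has $\mathrm{MC}_{k,l}(G)$ equal to the free abelian group on the tuples $(x_0,\ldots,x_k)\in V(G)^{k+1}$ with $x_i\neq x_{i+1}$ for all $i$ and $\ell(x_0,\ldots,x_k)=l$, with differential $\partial=\sum_{1\le i\le k-1}(-1)^i\partial_i:\mathrm{MC}_{k,l}(G)\to \mathrm{MC}_{k-1,l}(G)$, where $\partial_i(x_0,\ldots,x_k)=(x_0,\ldots,\hat x_i,\ldots,x_k)$ if $\ell(x_0,\ldots,\hat x_i,\ldots,x_k)=\ell(x_0,\ldots,x_k)$ and $0$ otherwise. Magnitude homology is $\mathrm{MH}_{k,l}(G)=H_k(\mathrm{MC}_{*,l}(G))$. A graph is diagonal if $\mathrm{MH}_{k,l}(G)\ne 0$ only when $k=l$. -}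

module Defs where

open import Data.Bool using (Bool; true; false; _∨_; _∧_; if_then_else_)
open import Data.Nat using (ℕ; zero; suc; _+_; _≡ᵇ_)
open import Data.Fin using (Fin; zero; suc; toℕ; inject₁)
open import Data.Fin.Properties using (_≟_)
open import Data.Bool.ListAction using (any)
open import Data.Vec.Properties using (≡-dec)
open import Data.List using (List; []; _∷_; allFin; concatMap; map; foldr)
open import Data.Vec using (Vec; []; _∷_; removeAt)
open import Data.Integer using (ℤ; _*_; -_; 0ℤ; 1ℤ) renaming (_+_ to _+ℤ_)
open import Data.Product using (_×_; _,_; ∃-syntax)
open import Data.Unit using (⊤)
open import Relation.Nullary using (¬_; does)
open import Relation.Binary.PropositionalEquality using (_≡_; _≢_)

-- A finite simple graph on vertex set Fin n, given by a Boolean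
-- adjacency relation (assumed symmetric and irreflexive, connected).

Adj : ℕ → Set
Adj n = Fin n → Fin n → Bool

_==_ : ∀ {n} → Fin n → Fin n → Bool
x == y = does (x ≟ y)

reach : ∀ {n} → Adj n → ℕ → Fin n → Fin n → Bool
reach adj zero    x y = x == y
reach {n} adj (suc k) x y =
  reach adj k x y ∨ any (λ z → reach adj k x z ∧ adj z y) (allFin n)

search : ∀ {n} → Adj n → Fin n → Fin n → ℕ → ℕ → ℕ
search adj x y i zero       = i
search adj x y i (suc fuel) =
  if reach adj i x y then i else search adj x y (suc i) fuel

-- shortest-path distance (for connected graphs on n vertices the least
-- k with a walk of length k is found among 0,…,n)
dist : ∀ {n} → Adj n → Fin n → Fin n → ℕ
dist {n} adj x y = search adj x y 0 n

len : ∀ {n m} → Adj n → Vec (Fin n) m → ℕ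
len adj []               = 0
len adj (x ∷ [])         = 0
len adj (x ∷ (y ∷ xs))   = dist adj x y + len adj (y ∷ xs)

ConsecDistinct : ∀ {n m} → Vec (Fin n) m → Set
ConsecDistinct []             = ⊤
ConsecDistinct (x ∷ [])       = ⊤
ConsecDistinct (x ∷ (y ∷ xs)) = (x ≢ y) × ConsecDistinct (y ∷ xs)

IsGen : ∀ {n k} → Adj n → ℕ → Vec (Fin n) (suc k) → Set
IsGen adj l x = ConsecDistinct x × len adj x ≡ l

-- An element of MC_{k,l}(G) (free abelian group) is represented by its
-- coefficient function on all (k+1)-tuples, vanishing off generators.
Chain : ℕ → ℕ → Set
Chain n k = Vec (Fin n) (suc k) → ℤ

Supported : ∀ {n k} → Adj n → ℕ → Chain n k → Set
Supported adj l c = ∀ x → c x ≢ 0ℤ → IsGen adj l x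

allVecs : ∀ n m → List (Vec (Fin n) m)
allVecs n zero    = [] ∷ []
allVecs n (suc m) = concatMap (λ v → map (v ∷_) (allVecs n m)) (allFin n)

sumℤ : List ℤ → ℤ
sumℤ = foldr _+ℤ_ 0ℤ

sign : ℕ → ℤ
sign zero    = 1ℤ
sign (suc i) = - sign i

faceCoeff : ∀ {n k} → Adj n → Vec (Fin n) (suc (suc k)) → Fin (suc (suc k))
          → Vec (Fin n) (suc k) → ℤ
faceCoeff adj x i y with len adj (removeAt x i) ≡ᵇ len adj x | does (≡-dec _≟_ (removeAt x i) y)
... | true  | true = 1ℤ
... | _     | _    = 0ℤ

-- differential ∂ = Σ_{1 ≤ i ≤ k} (-1)^i ∂_i : MC_{k+1,l} → MC_{k,l}
-- (the tuple in the domain is (x₀,…,x_{k+1}), so i ranges over 1,…,k)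
∂ : ∀ {n k} → Adj n → Chain n (suc k) → Chain n k
∂ {n} {k} adj c y =
  sumℤ (map (λ x →
    sumℤ (map (λ j → sign (suc (toℕ j)) * (faceCoeff adj x (suc (inject₁ j)) y * c x))
              (allFin k)))
    (allVecs n (suc (suc k))))

-- c ∈ MC_{k,l} is a cycle (∂ on MC_{0,l} is the zero map)
IsCycle : ∀ {n k} → Adj n → Chain n k → Set
IsCycle {k = zero}  adj c = ⊤
IsCycle {k = suc k} adj c = ∀ y → ∂ adj c y ≡ 0ℤ

MHvanishes : ∀ {n} → Adj n → ℕ → ℕ → Set
MHvanishes {n} adj k l =
  (c : Chain n k) → Supported adj l c → IsCycle adj c →
  ∃[ b ] (Supported adj l b × (∀ y → ∂ adj b y ≡ c y))

Diagonal : ∀ {n} → Adj n → Set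
Diagonal adj = ∀ k l → k ≢ l → MHvanishes adj k l

-- The icosahedral graph. Vertices: 0 = top, 1..5 upper pentagon,
-- 6..10 lower pentagon, 11 = bottom. Upper 1+a is adjacent to lower
-- 6+a and 6+(a-1 mod 5).

icoEdges : List (ℕ × ℕ)
icoEdges =
  (0 , 1) ∷ (0 , 2) ∷ (0 , 3) ∷ (0 , 4) ∷ (0 , 5) ∷
  (1 , 2) ∷ (2 , 3) ∷ (3 , 4) ∷ (4 , 5) ∷ (5 , 1) ∷
  (1 , 6) ∷ (2 , 7) ∷ (3 , 8) ∷ (4 , 9) ∷ (5 , 10) ∷
  (1 , 10) ∷ (2 , 6) ∷ (3 , 7) ∷ (4 , 8) ∷ (5 , 9) ∷
  (6 , 7) ∷ (7 , 8) ∷ (8 , 9) ∷ (9 , 10) ∷ (10 , 6) ∷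
  (11 , 6) ∷ (11 , 7) ∷ (11 , 8) ∷ (11 , 9) ∷ (11 , 10) ∷ []

icosahedron : Adj 12
icosahedron x y =
  any (λ e → let (a , b) = e in
        ((toℕ x ≡ᵇ a) ∧ (toℕ y ≡ᵇ b)) ∨ ((toℕ x ≡ᵇ b) ∧ (toℕ y ≡ᵇ a)))
      icoEdges

{-# OPTIONS --safe #-}
module Submission where

-- Let A be the algebra with basis e_xz, graded by d x z, where e_xy e_yz is e_xz if y lies on a geodesic from x to z
-- and 0 otherwise.  Magnitude homology is Tor^A(S , S) for S the degree 0 part of A, so diagonality is Koszulness of A.
-- A Koszul filtration exists: take the right ideals of e_x A generated by an arc of consecutive neighbours of x.
-- Removing an end y of the arc leaves an arc, and the annihilator of e_xy modulo the remaining ideal is generated by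
-- an arc around y (of 3 neighbours if y was the only generator, 5 if the arc was all of them, and 4 otherwise).
-- Cycles are then filled by induction on the degree and the length of the arc: a cycle is first pushed onto tuples
-- that start with (x , y) or lie in the smaller ideal, its part at y is a cycle over the annihilator, and filling
-- that part by induction leaves a cycle over the smaller ideal.

open import Defs
open import Data.Bool using (Bool; true; false; _∧_; _∨_; not; T)
open import Data.Bool.Properties using (¬-not; ∨-zeroʳ; ∨-identityʳ) renaming (_≟_ to _≟ᵇ_)
open import Data.Empty using (⊥-elim)
open import Data.Fin using (Fin; zero; suc; toℕ; inject₁; #_)
open import Data.Fin.Properties using (_≟_; all?)
open import Data.Integer using (ℤ; _*_; -_; 0ℤ; 1ℤ) renaming (_+_ to _+ℤ_)
import Data.Integer.Properties as ℤ
open import Data.Integer.Tactic.RingSolver using (solve-∀)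
open import Data.List using (List; []; _∷_; _++_; map; concatMap; tabulate; allFin)
open import Data.List.Properties using (map-++; map-∘)
open import Data.Nat using (ℕ; zero; suc; _+_; _≤_; _<_; _≡ᵇ_)
import Data.Nat.Properties as ℕ
open import Data.Product using (_×_; _,_; proj₁; proj₂; ∃-syntax)
open import Data.Sum using (_⊎_; inj₁; inj₂)
open import Data.Unit using (⊤; tt)
open import Data.Vec using (Vec; []; _∷_; head; lookup; removeAt)
open import Data.Vec.Properties using (≡-dec)
open import Function using (_∘_; id; case_of_)
open import Relation.Binary.PropositionalEquality
open import Relation.Nullary using (¬_; yes; no; does; ¬?)
open import Relation.Nullary.Decidable using (decidable-stable; toSum; from-yes; _→-dec_; dec-true; dec-false)
open import Algebra.Properties.Semiring.Sum ℤ.+-*-semiring using (sum; sum-cong-≗; sum-replicate-zero; ∑-distrib-+; ∑-comm; *-distribˡ-sum)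
open ≡-Reasoning

private variable
  n m k : ℕ

-- Sums over lists and over tuples.

sumℤ-++ : ∀ xs ys → sumℤ (xs ++ ys) ≡ sumℤ xs +ℤ sumℤ ys
sumℤ-++ []       ys = sym (ℤ.+-identityˡ _)
sumℤ-++ (x ∷ xs) ys = trans (cong (x +ℤ_) (sumℤ-++ xs ys)) (sym (ℤ.+-assoc x _ _))

sumℤ-concatMap : ∀ {A B : Set} (F : B → ℤ) (g : A → List B) xs →
  sumℤ (map F (concatMap g xs)) ≡ sumℤ (map (λ x → sumℤ (map F (g x))) xs)
sumℤ-concatMap F g []       = refl
sumℤ-concatMap F g (x ∷ xs) = begin
  sumℤ (map F (g x ++ concatMap g xs))                    ≡⟨ cong sumℤ (map-++ F (g x) _) ⟩
  sumℤ (map F (g x) ++ map F (concatMap g xs))            ≡⟨ sumℤ-++ (map F (g x)) _ ⟩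
  sumℤ (map F (g x)) +ℤ sumℤ (map F (concatMap g xs))     ≡⟨ cong (sumℤ (map F (g x)) +ℤ_) (sumℤ-concatMap F g xs) ⟩
  sumℤ (map (λ y → sumℤ (map F (g y))) (x ∷ xs))          ∎

sumℤ-tabulate : ∀ {A : Set} (F : A → ℤ) (h : Fin n → A) → sumℤ (map F (tabulate h)) ≡ sum (F ∘ h)
sumℤ-tabulate {zero}  F h = refl
sumℤ-tabulate {suc n} F h = cong (F (h zero) +ℤ_) (sumℤ-tabulate F (h ∘ suc))

-- Summation one entry at a time, so that an indicator on the first entry can be pulled out and
-- collapsed before the other entries are touched.
sumVec : ∀ m → (Vec (Fin n) m → ℤ) → ℤ
sumVec zero    F = F []
sumVec (suc m) F = sum λ v → sumVec m (F ∘ (v ∷_))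

sumℤ-allVecs : ∀ m (F : Vec (Fin n) m → ℤ) → sumℤ (map F (allVecs n m)) ≡ sumVec m F
sumℤ-allVecs         zero    F = ℤ.+-identityʳ (F [])
sumℤ-allVecs {n = n} (suc m) F = begin
  sumℤ (map F (concatMap (λ v → map (v ∷_) (allVecs n m)) (allFin n)))
    ≡⟨ sumℤ-concatMap F (λ v → map (v ∷_) (allVecs n m)) (allFin n) ⟩
  sumℤ (map (λ v → sumℤ (map F (map (v ∷_) (allVecs n m)))) (allFin n))
    ≡⟨ sumℤ-tabulate (λ v → sumℤ (map F (map (v ∷_) (allVecs n m)))) id ⟩
  sum (λ v → sumℤ (map F (map (v ∷_) (allVecs n m))))
    ≡⟨ sum-cong-≗ (λ v → trans (cong sumℤ (sym (map-∘ (allVecs n m)))) (sumℤ-allVecs m (F ∘ (v ∷_)))) ⟩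
  sum (λ v → sumVec m (F ∘ (v ∷_))) ∎

sum-zero : (F : Fin n → ℤ) → (∀ i → F i ≡ 0ℤ) → sum F ≡ 0ℤ
sum-zero {n} F F≗0 = trans (sum-cong-≗ F≗0) (sum-replicate-zero n)

sum-≢0 : (F : Fin n → ℤ) → sum F ≢ 0ℤ → ∃[ i ] F i ≢ 0ℤ
sum-≢0 {zero}  F Σ≢0 = ⊥-elim (Σ≢0 refl)
sum-≢0 {suc n} F Σ≢0 with F zero ℤ.≟ 0ℤ
... | no  F₀≢0 = zero , F₀≢0
... | yes F₀≡0 with i , Fᵢ≢0 ← sum-≢0 (F ∘ suc) (λ Σ≡0 → Σ≢0 (cong₂ _+ℤ_ F₀≡0 Σ≡0)) = suc i , Fᵢ≢0

sumVec-cong : ∀ m {F G : Vec (Fin n) m → ℤ} → F ≗ G → sumVec m F ≡ sumVec m G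
sumVec-cong zero    F≗G = F≗G []
sumVec-cong (suc m) F≗G = sum-cong-≗ λ v → sumVec-cong m (F≗G ∘ (v ∷_))

sumVec-+ : ∀ m (F G : Vec (Fin n) m → ℤ) → sumVec m (λ x → F x +ℤ G x) ≡ sumVec m F +ℤ sumVec m G
sumVec-+ zero    F G = refl
sumVec-+ (suc m) F G = trans (sum-cong-≗ λ v → sumVec-+ m (F ∘ (v ∷_)) (G ∘ (v ∷_)))
  (∑-distrib-+ (λ v → sumVec m (F ∘ (v ∷_))) (λ v → sumVec m (G ∘ (v ∷_))))

sumVec-* : ∀ m a (F : Vec (Fin n) m → ℤ) → sumVec m (λ x → a * F x) ≡ a * sumVec m F
sumVec-* zero    a F = refl
sumVec-* (suc m) a F = trans (sum-cong-≗ λ v → sumVec-* m a (F ∘ (v ∷_))) (sym (*-distribˡ-sum a (λ v → sumVec m (F ∘ (v ∷_)))))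

-- Indicators, Boolean comparisons and nonzero integers.

⟦_⟧ : Bool → ℤ
⟦ true  ⟧ = 1ℤ
⟦ false ⟧ = 0ℤ

⟦∧⟧ : ∀ p q → ⟦ p ∧ q ⟧ ≡ ⟦ p ⟧ * ⟦ q ⟧
⟦∧⟧ true  q = sym (ℤ.*-identityˡ ⟦ q ⟧)
⟦∧⟧ false q = refl

*-swap : ∀ p q r → p * (q * r) ≡ q * (p * r)
*-swap = solve-∀

sum-indicator : ∀ (a : Fin n) (G : Fin n → ℤ) → sum (λ u → ⟦ u == a ⟧ * G u) ≡ G a
sum-indicator zero    G = trans (cong₂ _+ℤ_ (ℤ.*-identityˡ (G zero)) (sum-zero (λ u → ⟦ suc u == zero ⟧ * G (suc u)) λ _ → refl))
  (ℤ.+-identityʳ (G zero))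
sum-indicator (suc a) G = trans (ℤ.+-identityˡ _) (sum-indicator a (G ∘ suc))

sum-single : ∀ (a : Fin n) (G : Fin n → ℤ) → (∀ u → u ≢ a → G u ≡ 0ℤ) → sum G ≡ G a
sum-single a G G≡0 = trans (sum-cong-≗ only-a) (sum-indicator a G)
  where
  only-a : ∀ u → G u ≡ ⟦ u == a ⟧ * G u
  only-a u with u ≟ a
  ... | yes _   = sym (ℤ.*-identityˡ (G u))
  ... | no  u≢a = G≡0 u u≢a

sumVec-indicator : ∀ m (Y : Vec (Fin n) m) (G : Vec (Fin n) m → ℤ) →
  sumVec m (λ X → ⟦ does (≡-dec _≟_ X Y) ⟧ * G X) ≡ G Y
sumVec-indicator zero    []      G = ℤ.*-identityˡ (G [])
sumVec-indicator (suc m) (y ∷ Y) G = begin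
  sum (λ u → sumVec m λ X → ⟦ (u == y) ∧ does (≡-dec _≟_ X Y) ⟧ * G (u ∷ X))
    ≡⟨ sum-cong-≗ (λ u → sumVec-cong m λ X → trans (cong (_* G (u ∷ X)) (⟦∧⟧ (u == y) _)) (ℤ.*-assoc ⟦ u == y ⟧ _ _)) ⟩
  sum (λ u → sumVec m λ X → ⟦ u == y ⟧ * (⟦ does (≡-dec _≟_ X Y) ⟧ * G (u ∷ X)))
    ≡⟨ sum-cong-≗ (λ u → trans (sumVec-* m ⟦ u == y ⟧ _) (cong (⟦ u == y ⟧ *_) (sumVec-indicator m Y (G ∘ (u ∷_))))) ⟩
  sum (λ u → ⟦ u == y ⟧ * G (u ∷ Y))
    ≡⟨ sum-indicator y (λ u → G (u ∷ Y)) ⟩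
  G (y ∷ Y) ∎

+-cancelˡ-≡ᵇ : ∀ p a b → (p + a ≡ᵇ p + b) ≡ (a ≡ᵇ b)
+-cancelˡ-≡ᵇ zero    a b = refl
+-cancelˡ-≡ᵇ (suc p) a b = +-cancelˡ-≡ᵇ p a b

≡ᵇ-sym : ∀ a b → (a ≡ᵇ b) ≡ (b ≡ᵇ a)
≡ᵇ-sym zero    zero    = refl
≡ᵇ-sym zero    (suc b) = refl
≡ᵇ-sym (suc a) zero    = refl
≡ᵇ-sym (suc a) (suc b) = ≡ᵇ-sym a b

+-cancelʳ-≡ᵇ : ∀ p a b → (a + p ≡ᵇ b + p) ≡ (a ≡ᵇ b)
+-cancelʳ-≡ᵇ p a b = trans (cong₂ _≡ᵇ_ (ℕ.+-comm a p) (ℕ.+-comm b p)) (+-cancelˡ-≡ᵇ p a b)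

≡ᵇ-true : ∀ {a b} → a ≡ b → (a ≡ᵇ b) ≡ true
≡ᵇ-true {a} {b} = dec-true (a ℕ.≟ b)

≡ᵇ-false : ∀ {a b} → a ≢ b → (a ≡ᵇ b) ≡ false
≡ᵇ-false {a} {b} = dec-false (a ℕ.≟ b)

⟦≡ᵇ⟧-true : ∀ {a b} → a ≡ b → ⟦ a ≡ᵇ b ⟧ ≡ 1ℤ
⟦≡ᵇ⟧-true a≡b = cong ⟦_⟧ (≡ᵇ-true a≡b)

⟦≡ᵇ⟧-≢0 : ∀ a b → ⟦ a ≡ᵇ b ⟧ ≢ 0ℤ → a ≡ b
⟦≡ᵇ⟧-≢0 a b ≢0 with a ≡ᵇ b in eq
... | true  = ℕ.≡ᵇ⇒≡ a b (subst T (sym eq) tt)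
... | false = ⊥-elim (≢0 refl)

==-refl : (a : Fin n) → ⟦ a == a ⟧ ≡ 1ℤ
==-refl a = cong ⟦_⟧ (dec-true (a ≟ a) refl)

==-≢ : {a b : Fin n} → a ≢ b → ⟦ a == b ⟧ ≡ 0ℤ
==-≢ {a = a} {b} a≢b = cong ⟦_⟧ (dec-false (a ≟ b) a≢b)

+-≢0 : ∀ a b → a +ℤ b ≢ 0ℤ → a ≢ 0ℤ ⊎ b ≢ 0ℤ
+-≢0 a b a+b≢0 with a ℤ.≟ 0ℤ | b ℤ.≟ 0ℤ
... | no a≢0  | _        = inj₁ a≢0
... | yes _   | no b≢0   = inj₂ b≢0
... | yes refl | yes refl = ⊥-elim (a+b≢0 refl)

*-≢0ˡ : ∀ a b → a * b ≢ 0ℤ → a ≢ 0ℤ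
*-≢0ˡ a b ab≢0 refl = ab≢0 refl

*-≢0ʳ : ∀ a b → a * b ≢ 0ℤ → b ≢ 0ℤ
*-≢0ʳ a b ab≢0 refl = ab≢0 (ℤ.*-zeroʳ a)

neg-≢0 : ∀ a → - a ≢ 0ℤ → a ≢ 0ℤ
neg-≢0 a -a≢0 refl = -a≢0 refl

≡0-stable : ∀ {a} → ¬ (a ≢ 0ℤ) → a ≡ 0ℤ
≡0-stable = decidable-stable (_ ℤ.≟ 0ℤ)

-- The differential on tuples with a fixed first entry.

module Based {n} (d : Fin n → Fin n → ℕ) where

  -- The structure constants of the algebra: `e_av e_vb` is `δ a v b` times `e_ab`.
  δ : Fin n → Fin n → Fin n → ℤ
  δ a v b = ⟦ d a v + d v b ≡ᵇ d a b ⟧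

  -- The differential on tuples with first entry x, as an operator on functions of the remaining entries.
  D : Fin n → (Vec (Fin n) (suc m) → ℤ) → Vec (Fin n) m → ℤ
  D x f []      = 0ℤ
  D x f (b ∷ t) = - (sum (λ v → δ x v b * f (v ∷ b ∷ t)) +ℤ D b (f ∘ (b ∷_)) t)

  D-cong : ∀ x {f g : Vec (Fin n) (suc m) → ℤ} → f ≗ g → D x f ≗ D x g
  D-cong x f≗g []      = refl
  D-cong x f≗g (b ∷ t) = cong -_ (cong₂ _+ℤ_ (sum-cong-≗ λ v → cong (δ x v b *_) (f≗g _)) (D-cong b (f≗g ∘ (b ∷_)) t))

  D-+ : ∀ x (f g : Vec (Fin n) (suc m) → ℤ) t → D x (λ s → f s +ℤ g s) t ≡ D x f t +ℤ D x g t
  D-+ x f g []      = refl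
  D-+ x f g (b ∷ t) = begin
    - (sum (λ v → δ x v b * (f (v ∷ b ∷ t) +ℤ g (v ∷ b ∷ t))) +ℤ D b (λ s → f (b ∷ s) +ℤ g (b ∷ s)) t)
      ≡⟨ cong -_ (cong₂ _+ℤ_ (trans (sum-cong-≗ λ v → ℤ.*-distribˡ-+ (δ x v b) _ _) (∑-distrib-+ F G)) (D-+ b (f ∘ (b ∷_)) (g ∘ (b ∷_)) t)) ⟩
    - ((sum F +ℤ sum G) +ℤ (D b (f ∘ (b ∷_)) t +ℤ D b (g ∘ (b ∷_)) t))
      ≡⟨ rearrange (sum F) (sum G) _ _ ⟩
    D x f (b ∷ t) +ℤ D x g (b ∷ t) ∎
    where
    F = λ v → δ x v b * f (v ∷ b ∷ t)
    G = λ v → δ x v b * g (v ∷ b ∷ t)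
    rearrange : ∀ p q r s → - ((p +ℤ q) +ℤ (r +ℤ s)) ≡ - (p +ℤ r) +ℤ - (q +ℤ s)
    rearrange = solve-∀

  D-* : ∀ x a (f : Vec (Fin n) (suc m) → ℤ) t → D x (λ s → a * f s) t ≡ a * D x f t
  D-* x a f []      = sym (ℤ.*-zeroʳ a)
  D-* x a f (b ∷ t) = begin
    - (sum (λ v → δ x v b * (a * f (v ∷ b ∷ t))) +ℤ D b (λ s → a * f (b ∷ s)) t)
      ≡⟨ cong -_ (cong₂ _+ℤ_ (trans (sum-cong-≗ λ v → *-swap (δ x v b) a _) (sym (*-distribˡ-sum a F))) (D-* b a (f ∘ (b ∷_)) t)) ⟩
    - (a * sum F +ℤ a * D b (f ∘ (b ∷_)) t)
      ≡⟨ factor a _ _ ⟩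
    a * D x f (b ∷ t) ∎
    where
    F = λ v → δ x v b * f (v ∷ b ∷ t)
    factor : ∀ p q r → - (p * q +ℤ p * r) ≡ p * - (q +ℤ r)
    factor = solve-∀

  D-zero : ∀ x {f : Vec (Fin n) (suc m) → ℤ} → (∀ s → f s ≡ 0ℤ) → ∀ t → D x f t ≡ 0ℤ
  D-zero x {f} f≗0 t = trans (D-cong x f≗0 t) (D-* x 0ℤ (λ _ → 0ℤ) t)

  D-linear : ∀ x (a : Fin k → ℤ) (F : Fin k → Vec (Fin n) (suc m) → ℤ) t →
    D x (λ s → sum (λ i → a i * F i s)) t ≡ sum (λ i → a i * D x (F i) t)
  D-linear {zero}  x a F t = D-zero x (λ _ → refl) t
  D-linear {suc k} x a F t = trans (D-+ x _ _ t) (cong₂ _+ℤ_ (D-* x (a zero) (F zero) t) (D-linear x (a ∘ suc) (F ∘ suc) t))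

  cone : Fin n → (Vec (Fin n) m → ℤ) → Vec (Fin n) (suc m) → ℤ
  cone y e (v ∷ s) = ⟦ v == y ⟧ * e s

  -- Deleting the inserted `y` gives the first term. All later faces keep `y` as the entry after
  -- `x`, so they occur only when `b` is `y`, and there they form the differential of `e` based at
  -- `y`.
  D-cone : ∀ x y (e : Vec (Fin n) (suc m) → ℤ) b t →
    D x (cone y e) (b ∷ t) ≡ - (δ x y b * e (b ∷ t) +ℤ ⟦ b == y ⟧ * D b e t)
  D-cone x y e b t = cong -_ (cong₂ _+ℤ_
    (trans (sum-cong-≗ λ v → *-swap (δ x v b) ⟦ v == y ⟧ _) (sum-indicator y (λ v → δ x v b * e (b ∷ t))))
    (D-* b ⟦ b == y ⟧ e t))

  -- Deletion of one interior entry that lies on a geodesic between its two neighbours in the tuple.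
  -- It carries statements about supports through `D` without computing any coefficient.
  data Face : Fin n → Vec (Fin n) (suc m) → Vec (Fin n) m → Set where
    here  : ∀ {x v b} {t : Vec (Fin n) m} → d x v + d v b ≡ d x b → Face x (v ∷ b ∷ t) (b ∷ t)
    there : ∀ {x b} {s : Vec (Fin n) (suc m)} {t} → Face b s t → Face x (b ∷ s) (b ∷ t)

  D-≢0 : ∀ x (f : Vec (Fin n) (suc m) → ℤ) t → D x f t ≢ 0ℤ → ∃[ s ] f s ≢ 0ℤ × Face x s t
  D-≢0 x f []      D≢0 = ⊥-elim (D≢0 refl)
  D-≢0 x f (b ∷ t) D≢0 with +-≢0 _ _ (neg-≢0 _ D≢0)
  ... | inj₁ Σ≢0 with v , F≢0 ← sum-≢0 _ Σ≢0 =
        v ∷ b ∷ t , *-≢0ʳ (δ x v b) _ F≢0 , here (⟦≡ᵇ⟧-≢0 (d x v + d v b) (d x b) (*-≢0ˡ (δ x v b) _ F≢0))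
  ... | inj₂ D'≢0 with s , f≢0 , face ← D-≢0 b (f ∘ (b ∷_)) t D'≢0 = b ∷ s , f≢0 , there face

  module _ (triangle : ∀ x y z → d x z ≤ d x y + d y z) where

    -- The triangle inequality squeezes `d x u + d u b` between `d x b` and the length of the path
    -- through `u` and `v`, which the hypotheses make equal.
    geodesic-assoc : ∀ {x u v b} → d x u + d u v ≡ d x v → d x v + d v b ≡ d x b →
      d x u + d u b ≡ d x b × d u v + d v b ≡ d u b
    geodesic-assoc {x} {u} {v} {b} xuv xvb = xub , ℕ.+-cancelˡ-≡ (d x u) _ _ (trans total (sym xub))
      where
      total : d x u + (d u v + d v b) ≡ d x b
      total = trans (sym (ℕ.+-assoc (d x u) _ _)) (trans (cong (_+ d v b) xuv) xvb)
      xub : d x u + d u b ≡ d x b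
      xub = ℕ.≤-antisym (ℕ.≤-trans (ℕ.+-monoʳ-≤ (d x u) (triangle u v b)) (ℕ.≤-reflexive total)) (triangle x u b)

    geodesic-assoc⁻ : ∀ {x u v b} → d x u + d u b ≡ d x b → d u v + d v b ≡ d u b →
      d x u + d u v ≡ d x v × d x v + d v b ≡ d x b
    geodesic-assoc⁻ {x} {u} {v} {b} xub uvb = ℕ.+-cancelʳ-≡ (d v b) _ _ (trans total (sym xvb)) , xvb
      where
      total : d x u + d u v + d v b ≡ d x b
      total = trans (ℕ.+-assoc (d x u) _ _) (trans (cong (d x u +_) uvb) xub)
      xvb : d x v + d v b ≡ d x b
      xvb = ℕ.≤-antisym (ℕ.≤-trans (ℕ.+-monoˡ-≤ (d v b) (triangle x u v)) (ℕ.≤-reflexive total)) (triangle x v b)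

    -- Associativity of the algebra: either product is 1 exactly when `x`, `u`, `v`, `b` occur in
    -- this order on one geodesic.
    δ-assoc : ∀ x u v b → δ x v b * δ x u v ≡ δ x u b * δ u v b
    δ-assoc x u v b with δ x v b * δ x u v ℤ.≟ 0ℤ | δ x u b * δ u v b ℤ.≟ 0ℤ
    ... | yes l≡0 | yes r≡0 = trans l≡0 (sym r≡0)
    ... | no  l≢0 | _ = trans (cong₂ _*_ (⟦≡ᵇ⟧-true xvb) (⟦≡ᵇ⟧-true xuv))
                              (sym (cong₂ _*_ (⟦≡ᵇ⟧-true (proj₁ both)) (⟦≡ᵇ⟧-true (proj₂ both))))
      where
      xvb = ⟦≡ᵇ⟧-≢0 _ _ (*-≢0ˡ (δ x v b) _ l≢0)
      xuv = ⟦≡ᵇ⟧-≢0 _ _ (*-≢0ʳ (δ x v b) _ l≢0)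
      both = geodesic-assoc xuv xvb
    ... | _ | no r≢0 = trans (cong₂ _*_ (⟦≡ᵇ⟧-true (proj₂ both)) (⟦≡ᵇ⟧-true (proj₁ both)))
                             (sym (cong₂ _*_ (⟦≡ᵇ⟧-true xub) (⟦≡ᵇ⟧-true uvb)))
      where
      xub = ⟦≡ᵇ⟧-≢0 _ _ (*-≢0ˡ (δ x u b) _ r≢0)
      uvb = ⟦≡ᵇ⟧-≢0 _ _ (*-≢0ʳ (δ x u b) _ r≢0)
      both = geodesic-assoc⁻ xub uvb

    -- Deleting the first two interior entries in either order cancels by `δ-assoc`. Deleting the
    -- first one and one to the right of `b` cancels by sign, and two deletions to the right of `b`
    -- cancel by induction.
    D∘D : ∀ x (g : Vec (Fin n) (suc (suc m)) → ℤ) t → D x (D x g) t ≡ 0ℤ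
    D∘D x g []      = refl
    D∘D x g (b ∷ t) = begin
      - (sum (λ v → δ x v b * D x g (v ∷ b ∷ t)) +ℤ D b (D x g ∘ (b ∷_)) t)
        ≡⟨ cong₂ (λ p q → - (p +ℤ q)) first second ⟩
      - (sum B +ℤ - sum B)
        ≡⟨ cong -_ (ℤ.+-inverseʳ (sum B)) ⟩
      0ℤ ∎
      where
      B A C : Fin n → ℤ
      -- `B` deletes `v` and an entry to the right of `b`. `A` deletes `w` from `(x , v , w , b)`
      -- and then `v`, while `C` deletes `u` from `(x , u , v , b)` and then `v`.
      B v = δ x v b * D b (λ s → g (v ∷ b ∷ s)) t
      A v = sum λ w → δ x v b * (δ v w b * g (v ∷ w ∷ b ∷ t))
      C v = sum λ u → δ x v b * (δ x u v * g (u ∷ v ∷ b ∷ t))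

      expand : ∀ p q r s → p * - (q +ℤ - (r +ℤ s)) ≡ (p * s +ℤ p * r) +ℤ - 1ℤ * (p * q)
      expand = solve-∀
      shuffle : ∀ p → - (p +ℤ 0ℤ) ≡ - p
      shuffle = solve-∀
      cancel : ∀ p q → (p +ℤ q) +ℤ - 1ℤ * q ≡ p
      cancel = solve-∀

      A≡C : sum A ≡ sum C
      A≡C = begin
        sum A ≡⟨ sum-cong-≗ (λ v → sum-cong-≗ λ w → trans (sym (ℤ.*-assoc (δ x v b) _ _))
                   (trans (cong (_* g (v ∷ w ∷ b ∷ t)) (sym (δ-assoc x v w b))) (ℤ.*-assoc (δ x w b) _ _))) ⟩
        sum (λ v → sum λ w → δ x w b * (δ x v w * g (v ∷ w ∷ b ∷ t)))
              ≡⟨ ∑-comm (λ v w → δ x w b * (δ x v w * g (v ∷ w ∷ b ∷ t))) ⟩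
        sum C ∎

      first : sum (λ v → δ x v b * D x g (v ∷ b ∷ t)) ≡ sum B
      first = begin
        sum (λ v → δ x v b * D x g (v ∷ b ∷ t))
          ≡⟨ sum-cong-≗ (λ v → trans (expand (δ x v b) _ _ _)
               (cong₂ (λ p q → (B v +ℤ p) +ℤ - 1ℤ * q)
                 (*-distribˡ-sum (δ x v b) (λ w → δ v w b * g (v ∷ w ∷ b ∷ t)))
                 (*-distribˡ-sum (δ x v b) (λ u → δ x u v * g (u ∷ v ∷ b ∷ t))))) ⟩
        sum (λ v → (B v +ℤ A v) +ℤ - 1ℤ * C v)
          ≡⟨ ∑-distrib-+ (λ v → B v +ℤ A v) (λ v → - 1ℤ * C v) ⟩
        sum (λ v → B v +ℤ A v) +ℤ sum (λ v → - 1ℤ * C v)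
          ≡⟨ cong₂ _+ℤ_ (∑-distrib-+ B A) (sym (*-distribˡ-sum (- 1ℤ) C)) ⟩
        (sum B +ℤ sum A) +ℤ - 1ℤ * sum C
          ≡⟨ cong (λ p → (sum B +ℤ p) +ℤ - 1ℤ * sum C) A≡C ⟩
        (sum B +ℤ sum C) +ℤ - 1ℤ * sum C
          ≡⟨ cancel (sum B) (sum C) ⟩
        sum B ∎

      second : D b (D x g ∘ (b ∷_)) t ≡ - sum B
      second = begin
        D b (λ s → - (S s +ℤ D b (g ∘ (b ∷_)) s)) t
          ≡⟨ D-cong b (λ s → sym (ℤ.-1*i≡-i (S s +ℤ D b (g ∘ (b ∷_)) s))) t ⟩
        D b (λ s → - 1ℤ * (S s +ℤ D b (g ∘ (b ∷_)) s)) t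
          ≡⟨ D-* b (- 1ℤ) _ t ⟩
        - 1ℤ * D b (λ s → S s +ℤ D b (g ∘ (b ∷_)) s) t
          ≡⟨ ℤ.-1*i≡-i _ ⟩
        - D b (λ s → S s +ℤ D b (g ∘ (b ∷_)) s) t
          ≡⟨ cong -_ (trans (D-+ b S _ t) (cong₂ _+ℤ_ (D-linear b (λ v → δ x v b) (λ v s → g (v ∷ b ∷ s)) t) (D∘D b (g ∘ (b ∷_)) t))) ⟩
        - (sum B +ℤ 0ℤ)
          ≡⟨ shuffle (sum B) ⟩
        - sum B ∎
        where S = λ s → sum λ v → δ x v b * g (v ∷ b ∷ s)

-- Comparison of the magnitude differential with the based one.

module _ {n} (adj : Adj n) (d : Fin n → Fin n → ℕ) (dist≡d : ∀ x y → dist adj x y ≡ d x y) where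
  open Based d

  len-∷ : ∀ x y (t : Vec (Fin n) m) → len adj (x ∷ y ∷ t) ≡ d x y + len adj (y ∷ t)
  len-∷ x y t = cong (_+ len adj (y ∷ t)) (dist≡d x y)

  faceCoeff-indicator : ∀ (x : Vec (Fin n) (suc (suc k))) i y →
    faceCoeff adj x i y ≡ ⟦ len adj (removeAt x i) ≡ᵇ len adj x ⟧ * ⟦ does (≡-dec _≟_ (removeAt x i) y) ⟧
  faceCoeff-indicator x i y with len adj (removeAt x i) ≡ᵇ len adj x | does (≡-dec _≟_ (removeAt x i) y)
  ... | true  | true  = refl
  ... | true  | false = refl
  ... | false | _     = refl

  -- The length of the tail from `head X` onwards cancels from the two lengths compared, which
  -- leaves the geodesic test for `v` between `u` and `head X`.
  faceCoeff-first : ∀ u v (X : Vec (Fin n) (suc k)) a b t →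
    faceCoeff adj (u ∷ v ∷ X) (suc zero) (a ∷ b ∷ t) ≡ ⟦ u == a ⟧ * (⟦ does (≡-dec _≟_ X (b ∷ t)) ⟧ * δ u v (head X))
  faceCoeff-first u v (w ∷ X) a b t = begin
    faceCoeff adj (u ∷ v ∷ w ∷ X) (suc zero) (a ∷ b ∷ t)
      ≡⟨ faceCoeff-indicator (u ∷ v ∷ w ∷ X) (suc zero) (a ∷ b ∷ t) ⟩
    ⟦ len adj (u ∷ w ∷ X) ≡ᵇ len adj (u ∷ v ∷ w ∷ X) ⟧ * ⟦ (u == a) ∧ E ⟧
      ≡⟨ cong₂ _*_ (cong ⟦_⟧ lengths) (⟦∧⟧ (u == a) E) ⟩
    δ u v w * (⟦ u == a ⟧ * ⟦ E ⟧)
      ≡⟨ rotate (δ u v w) ⟦ u == a ⟧ ⟦ E ⟧ ⟩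
    ⟦ u == a ⟧ * (⟦ E ⟧ * δ u v w) ∎
    where
    E = does (≡-dec _≟_ (w ∷ X) (b ∷ t))
    L = len adj (w ∷ X)
    rotate : ∀ p q r → p * (q * r) ≡ q * (r * p)
    rotate = solve-∀
    lengths : (len adj (u ∷ w ∷ X) ≡ᵇ len adj (u ∷ v ∷ w ∷ X)) ≡ (d u v + d v w ≡ᵇ d u w)
    lengths = begin
      (len adj (u ∷ w ∷ X) ≡ᵇ len adj (u ∷ v ∷ w ∷ X))
        ≡⟨ cong₂ _≡ᵇ_ (len-∷ u w X) (trans (len-∷ u v (w ∷ X)) (trans (cong (d u v +_) (len-∷ v w X)) (sym (ℕ.+-assoc (d u v) _ _)))) ⟩
      (d u w + L ≡ᵇ (d u v + d v w) + L)
        ≡⟨ +-cancelʳ-≡ᵇ L (d u w) (d u v + d v w) ⟩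
      (d u w ≡ᵇ d u v + d v w)
        ≡⟨ ≡ᵇ-sym (d u w) _ ⟩
      (d u v + d v w ≡ᵇ d u w) ∎

  -- The first two entries both survive, so the distance between them cancels from the two lengths
  -- compared.
  faceCoeff-later : ∀ u (X : Vec (Fin n) (suc (suc k))) i a y →
    faceCoeff adj (u ∷ X) (suc (suc i)) (a ∷ y) ≡ ⟦ u == a ⟧ * faceCoeff adj X (suc i) y
  faceCoeff-later u (v ∷ w ∷ X) i a y = begin
    faceCoeff adj (u ∷ v ∷ w ∷ X) (suc (suc i)) (a ∷ y)
      ≡⟨ faceCoeff-indicator (u ∷ v ∷ w ∷ X) (suc (suc i)) (a ∷ y) ⟩
    ⟦ len adj (u ∷ v ∷ R) ≡ᵇ len adj (u ∷ v ∷ w ∷ X) ⟧ * ⟦ (u == a) ∧ E ⟧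
      ≡⟨ cong₂ _*_ (cong ⟦_⟧ (+-cancelˡ-≡ᵇ (dist adj u v) (len adj (v ∷ R)) (len adj (v ∷ w ∷ X)))) (⟦∧⟧ (u == a) E) ⟩
    ⟦ len adj (v ∷ R) ≡ᵇ len adj (v ∷ w ∷ X) ⟧ * (⟦ u == a ⟧ * ⟦ E ⟧)
      ≡⟨ *-swap ⟦ len adj (v ∷ R) ≡ᵇ len adj (v ∷ w ∷ X) ⟧ ⟦ u == a ⟧ ⟦ E ⟧ ⟩
    ⟦ u == a ⟧ * (⟦ len adj (v ∷ R) ≡ᵇ len adj (v ∷ w ∷ X) ⟧ * ⟦ E ⟧)
      ≡⟨ cong (⟦ u == a ⟧ *_) (sym (faceCoeff-indicator (v ∷ w ∷ X) (suc i) y)) ⟩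
    ⟦ u == a ⟧ * faceCoeff adj (v ∷ w ∷ X) (suc i) y ∎
    where
    R = removeAt (w ∷ X) i
    E = does (≡-dec _≟_ (v ∷ R) y)

  face : Chain n (suc k) → Vec (Fin n) (suc k) → Vec (Fin n) (suc (suc k)) → Fin k → ℤ
  face c y x j = sign (suc (toℕ j)) * (faceCoeff adj x (suc (inject₁ j)) y * c x)

  ∂-sumVec : ∀ (c : Chain n (suc k)) y → ∂ adj c y ≡ sumVec (suc (suc k)) (λ x → sum (face c y x))
  ∂-sumVec {k} c y = trans (sumℤ-allVecs (suc (suc k)) (λ x → sumℤ (map (face c y x) (allFin k))))
    (sumVec-cong (suc (suc k)) λ x → sumℤ-tabulate (face c y x) id)

  -- The first entry is never deleted, so it can be frozen at `a`. The face at index 1 gives the sum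
  -- with `δ`. The other faces are those of the tail with the index shifted by one, which flips
  -- their signs and puts the recursive call under the same minus sign.
  ∂≡D : ∀ (c : Chain n (suc k)) a t → ∂ adj c (a ∷ t) ≡ D a (c ∘ (a ∷_)) t
  -- A pair has no interior entry, so every summand is an empty sum; `sumVec-*` with scalar 0
  -- evaluates the resulting sum of zeros.
  ∂≡D {zero} c a [] = trans (∂-sumVec c (a ∷ [])) (sumVec-* 2 0ℤ (λ (_ : Vec (Fin n) 2) → 0ℤ))
  ∂≡D {suc k} c a (b ∷ t) = begin
    ∂ adj c (a ∷ b ∷ t)
      ≡⟨ ∂-sumVec c (a ∷ b ∷ t) ⟩
    sumVec (3 + k) (λ x → sum (face c (a ∷ b ∷ t) x))
      ≡⟨ sumVec-+ (3 + k) (λ x → face c (a ∷ b ∷ t) x zero) (λ x → sum (face c (a ∷ b ∷ t) x ∘ suc)) ⟩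
    sumVec (3 + k) (λ x → face c (a ∷ b ∷ t) x zero) +ℤ sumVec (3 + k) (λ x → sum (face c (a ∷ b ∷ t) x ∘ suc))
      ≡⟨ cong₂ _+ℤ_ first later ⟩
    - 1ℤ * sum (λ v → δ a v b * c (a ∷ v ∷ b ∷ t)) +ℤ - 1ℤ * D b (λ s → c (a ∷ b ∷ s)) t
      ≡⟨ collect (sum (λ v → δ a v b * c (a ∷ v ∷ b ∷ t))) (D b (λ s → c (a ∷ b ∷ s)) t) ⟩
    D a (c ∘ (a ∷_)) (b ∷ t) ∎
    where
    collect : ∀ p q → - 1ℤ * p +ℤ - 1ℤ * q ≡ - (p +ℤ q)
    collect = solve-∀
    regroup₁ : ∀ s p q r e → s * ((p * (q * r)) * e) ≡ p * (s * (q * (r * e)))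
    regroup₁ = solve-∀
    regroup₂ : ∀ s p q e → - s * ((p * q) * e) ≡ p * (- 1ℤ * (s * (q * e)))
    regroup₂ = solve-∀

    G : Fin n → Fin n → Vec (Fin n) (suc k) → ℤ
    G u v X = δ u v (head X) * c (u ∷ v ∷ X)

    H : Fin n → Vec (Fin n) (2 + k) → ℤ
    H u X = sum (face (c ∘ (u ∷_)) (b ∷ t) X)

    first : sumVec (3 + k) (λ x → face c (a ∷ b ∷ t) x zero) ≡ - 1ℤ * sum (λ v → δ a v b * c (a ∷ v ∷ b ∷ t))
    first = begin
      sum (λ u → sum λ v → sumVec (suc k) λ X → face c (a ∷ b ∷ t) (u ∷ v ∷ X) zero)
        ≡⟨ sum-cong-≗ (λ u → sum-cong-≗ λ v → trans
             (sumVec-cong (suc k) λ X → trans (cong (λ p → - 1ℤ * (p * c (u ∷ v ∷ X))) (faceCoeff-first u v X a b t))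
               (regroup₁ (- 1ℤ) ⟦ u == a ⟧ ⟦ does (≡-dec _≟_ X (b ∷ t)) ⟧ _ _))
             (sumVec-* (suc k) ⟦ u == a ⟧ (λ X → - 1ℤ * (⟦ does (≡-dec _≟_ X (b ∷ t)) ⟧ * G u v X)))) ⟩
      sum (λ u → sum λ v → ⟦ u == a ⟧ * sumVec (suc k) (λ X → - 1ℤ * (⟦ does (≡-dec _≟_ X (b ∷ t)) ⟧ * G u v X)))
        ≡⟨ sum-cong-≗ (λ u → sum-cong-≗ λ v → cong (⟦ u == a ⟧ *_) (trans (sumVec-* (suc k) (- 1ℤ) (λ X → ⟦ does (≡-dec _≟_ X (b ∷ t)) ⟧ * G u v X))
             (cong (- 1ℤ *_) (sumVec-indicator (suc k) (b ∷ t) (G u v))))) ⟩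
      sum (λ u → sum λ v → ⟦ u == a ⟧ * (- 1ℤ * G u v (b ∷ t)))
        ≡⟨ sum-cong-≗ (λ u → trans (sym (*-distribˡ-sum ⟦ u == a ⟧ (λ v → - 1ℤ * G u v (b ∷ t))))
             (cong (⟦ u == a ⟧ *_) (sym (*-distribˡ-sum (- 1ℤ) (λ v → G u v (b ∷ t)))))) ⟩
      sum (λ u → ⟦ u == a ⟧ * (- 1ℤ * sum λ v → G u v (b ∷ t)))
        ≡⟨ sum-indicator a (λ u → - 1ℤ * sum λ v → G u v (b ∷ t)) ⟩
      - 1ℤ * sum (λ v → G a v (b ∷ t)) ∎

    later : sumVec (3 + k) (λ x → sum (face c (a ∷ b ∷ t) x ∘ suc)) ≡ - 1ℤ * D b (λ s → c (a ∷ b ∷ s)) t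
    later = begin
      sum (λ u → sumVec (2 + k) λ X → sum (face c (a ∷ b ∷ t) (u ∷ X) ∘ suc))
        ≡⟨ sum-cong-≗ (λ u → sumVec-cong (2 + k) λ X → trans
             (sum-cong-≗ λ j → trans (cong (λ p → sign (2 + toℕ j) * (p * c (u ∷ X))) (faceCoeff-later u X (inject₁ j) a (b ∷ t)))
               (regroup₂ (sign (suc (toℕ j))) ⟦ u == a ⟧ _ _))
             (trans (sym (*-distribˡ-sum ⟦ u == a ⟧ (λ j → - 1ℤ * face (c ∘ (u ∷_)) (b ∷ t) X j)))
               (cong (⟦ u == a ⟧ *_) (sym (*-distribˡ-sum (- 1ℤ) (face (c ∘ (u ∷_)) (b ∷ t) X)))))) ⟩
      sum (λ u → sumVec (2 + k) λ X → ⟦ u == a ⟧ * (- 1ℤ * H u X))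
        ≡⟨ sum-cong-≗ (λ u → trans (sumVec-* (2 + k) ⟦ u == a ⟧ (λ X → - 1ℤ * H u X)) (cong (⟦ u == a ⟧ *_) (sumVec-* (2 + k) (- 1ℤ) (H u)))) ⟩
      sum (λ u → ⟦ u == a ⟧ * (- 1ℤ * sumVec (2 + k) (H u)))
        ≡⟨ sum-indicator a (λ u → - 1ℤ * sumVec (2 + k) (H u)) ⟩
      - 1ℤ * sumVec (2 + k) (H a)
        ≡⟨ cong (- 1ℤ *_) (trans (sym (∂-sumVec (c ∘ (a ∷_)) (b ∷ t))) (∂≡D (c ∘ (a ∷_)) b t)) ⟩
      - 1ℤ * D b (λ s → c (a ∷ b ∷ s)) t ∎

-- Koszul filtrations by right ideals.

-- contains I z says that e_xz lies in the right ideal I of e_x A, and I has r generators when I : Ideal x r.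
-- colon I is the annihilator of gen I modulo rest I.
record KoszulFiltration {n} (d : Fin n → Fin n → ℕ) : Set₁ where
  field
    Ideal     : Fin n → ℕ → Set
    contains  : ∀ {x r} → Ideal x r → Fin n → Bool
    closed    : ∀ {x r} (I : Ideal x r) {z w} → contains I z ≡ true → d x z + d z w ≡ d x w → contains I w ≡ true
    empty     : ∀ {x} (I : Ideal x 0) z → contains I z ≡ false
    maxRank   : ℕ
    maximal   : ∀ x → Ideal x maxRank
    maximal-∋ : ∀ {x z} → x ≢ z → contains (maximal x) z ≡ true

    gen       : ∀ {x r} → Ideal x (suc r) → Fin n
    rest      : ∀ {x r} → Ideal x (suc r) → Ideal x r
    colonRank : ∀ {x r} → Ideal x (suc r) → ℕ
    colon     : ∀ {x r} (I : Ideal x (suc r)) → Ideal (gen I) (colonRank I)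

    gen-adjacent : ∀ {x r} (I : Ideal x (suc r)) → d x (gen I) ≡ 1
    gen-∋        : ∀ {x r} (I : Ideal x (suc r)) → contains I (gen I) ≡ true
    gen-∌        : ∀ {x r} (I : Ideal x (suc r)) → contains (rest I) (gen I) ≡ false
    rest-⊆       : ∀ {x r} (I : Ideal x (suc r)) {z} → contains (rest I) z ≡ true → contains I z ≡ true
    new-geodesic : ∀ {x r} (I : Ideal x (suc r)) {z} → contains I z ≡ true → contains (rest I) z ≡ false →
                   d x (gen I) + d (gen I) z ≡ d x z
    -- Let `y` be `gen I`. The product `e_xy e_yz` lies outside `rest I` exactly when `y` is on a
    -- geodesic from `x` to `z` and `z` is not in `rest I`. By `closed` and `new-geodesic` this
    -- means that `z` is in `I` but not in `rest I`, so the annihilator can be described by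
    -- membership alone.
    colon-∌-new  : ∀ {x r} (I : Ideal x (suc r)) {z} → contains (colon I) z ≡ true →
                   contains I z ≡ true → contains (rest I) z ≡ true
    colon-∋      : ∀ {x r} (I : Ideal x (suc r)) {z} → z ≢ gen I →
                   contains I z ≡ false ⊎ contains (rest I) z ≡ true → contains (colon I) z ≡ true

-- Filling cycles with the help of a Koszul filtration.

module Filtered {n} (adj : Adj n) (d : Fin n → Fin n → ℕ) (dist≡d : ∀ x y → dist adj x y ≡ d x y)
  (d-refl : ∀ x → d x x ≡ 0) (d≡0 : ∀ {x y} → d x y ≡ 0 → x ≡ y)
  (triangle : ∀ x y z → d x z ≤ d x y + d y z) (K : KoszulFiltration d) where

  open Based d
  open KoszulFiltration K

  private variable
    x : Fin n
    r l : ℕ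

  Face-len : ∀ {x} {s : Vec (Fin n) (suc m)} {t} → Face x s t → len adj (x ∷ s) ≡ len adj (x ∷ t)
  Face-len {x = x} (here {v = v} {b} {t} eq) = begin
    len adj (x ∷ v ∷ b ∷ t)              ≡⟨ len-∷ adj d dist≡d x v (b ∷ t) ⟩
    d x v + len adj (v ∷ b ∷ t)          ≡⟨ cong (d x v +_) (len-∷ adj d dist≡d v b t) ⟩
    d x v + (d v b + len adj (b ∷ t))    ≡⟨ sym (ℕ.+-assoc (d x v) _ _) ⟩
    d x v + d v b + len adj (b ∷ t)      ≡⟨ cong (_+ len adj (b ∷ t)) eq ⟩
    d x b + len adj (b ∷ t)              ≡⟨ sym (len-∷ adj d dist≡d x b t) ⟩
    len adj (x ∷ b ∷ t)                  ∎
  Face-len {x = x} (there {b = b} face) = cong (dist adj x b +_) (Face-len face)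

  -- Deletion could only make equal entries adjacent if `v` were on a geodesic from `x` to `x`,
  -- which forces `v` to be `x`.
  Face-distinct : ∀ {x} {s : Vec (Fin n) (suc m)} {t} → Face x s t → ConsecDistinct (x ∷ s) → ConsecDistinct (x ∷ t)
  Face-distinct {x = x} (here {v = v} eq) (x≢v , _ , rest-distinct) = x≢b , rest-distinct
    where
    x≢b : x ≢ _
    x≢b refl = x≢v (d≡0 (ℕ.m+n≡0⇒m≡0 (d x v) (trans eq (d-refl x))))
  Face-distinct (there face) (x≢b , distinct) = x≢b , Face-distinct face distinct

  Head∈ : Ideal x r → Vec (Fin n) k → Set
  Head∈ I []      = ⊤
  Head∈ I (z ∷ _) = contains I z ≡ true

  Face-head : (I : Ideal x r) {s : Vec (Fin n) (suc m)} {t : Vec (Fin n) m} → Face x s t → Head∈ I s → Head∈ I t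
  Face-head I (here eq) v∈I = closed I v∈I eq
  Face-head I (there _) b∈I = b∈I

  -- In positive degree these functions are the length `l` part of the normalized bar complex of the
  -- right ideal `I`, with the degree shifted by one.
  InIdeal : Ideal x r → ℕ → (Vec (Fin n) k → ℤ) → Set
  InIdeal {x} I l f = ∀ t → f t ≢ 0ℤ → IsGen adj l (x ∷ t) × Head∈ I t

  Cycle : Fin n → (Vec (Fin n) k → ℤ) → Set
  Cycle {zero}  x f = ⊤
  Cycle {suc k} x f = ∀ t → D x f t ≡ 0ℤ

  Boundary : Ideal x r → ℕ → (Vec (Fin n) k → ℤ) → Set
  Boundary {x} I l f = ∃[ g ] (InIdeal I l g × (∀ t → D x g t ≡ f t))

  Acyclic : Ideal x r → ℕ → ℕ → Set
  Acyclic {x} I k l = (f : Vec (Fin n) k → ℤ) → InIdeal I l f → Cycle x f → Boundary I l f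

  zero-boundary : (I : Ideal x r) (f : Vec (Fin n) k → ℤ) → (∀ t → f t ≡ 0ℤ) → Boundary I l f
  zero-boundary {x} I f f≗0 =
    (λ _ → 0ℤ) , (λ _ 0≢0 → ⊥-elim (0≢0 refl)) , λ t → trans (D-zero x (λ _ → refl) t) (sym (f≗0 t))

  D-InIdeal : (I : Ideal x r) (f : Vec (Fin n) (suc k) → ℤ) → InIdeal I l f → InIdeal I l (D x f)
  D-InIdeal {x} I f f∈ t D≢0 with s , f≢0 , face ← D-≢0 x f t D≢0 with (distinct , length) , head∈ ← f∈ s f≢0 =
    (Face-distinct face distinct , trans (sym (Face-len face)) length) , Face-head I face head∈

  +-InIdeal : (I : Ideal x r) (f g : Vec (Fin n) k → ℤ) → InIdeal I l f → InIdeal I l g → InIdeal I l (λ t → f t +ℤ g t)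
  +-InIdeal I f g f∈ g∈ t ≢0 with +-≢0 (f t) (g t) ≢0
  ... | inj₁ f≢0 = f∈ t f≢0
  ... | inj₂ g≢0 = g∈ t g≢0

  -- Allows a cycle to be replaced by a homologous one before it is filled.
  absorb-boundary : (I : Ideal x r) (f : Vec (Fin n) k → ℤ) (u : Vec (Fin n) (suc k) → ℤ) →
    InIdeal I l u → Boundary I l (λ t → f t +ℤ D x u t) → Boundary I l f
  absorb-boundary {x} I f u u∈ (g , g∈ , Dg) =
    (λ s → g s +ℤ - 1ℤ * u s) , +-InIdeal I g _ g∈ (λ s ≢0 → u∈ s (*-≢0ʳ (- 1ℤ) (u s) ≢0)) , λ t → begin
      D x (λ s → g s +ℤ - 1ℤ * u s) t          ≡⟨ D-+ x g _ t ⟩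
      D x g t +ℤ D x (λ s → - 1ℤ * u s) t      ≡⟨ cong₂ _+ℤ_ (Dg t) (D-* x (- 1ℤ) u t) ⟩
      (f t +ℤ D x u t) +ℤ - 1ℤ * D x u t       ≡⟨ cancel (f t) (D x u t) ⟩
      f t ∎
    where
    cancel : ∀ p q → (p +ℤ q) +ℤ - 1ℤ * q ≡ p
    cancel = solve-∀

  absorb-cycle : (f : Vec (Fin n) (suc k) → ℤ) (u : Vec (Fin n) (suc (suc k)) → ℤ) →
    Cycle x f → Cycle x (λ t → f t +ℤ D x u t)
  absorb-cycle {x = x} f u f-cycle t = trans (D-+ x f (D x u) t) (cong₂ _+ℤ_ (f-cycle t) (D∘D triangle x u t))

  cone-InIdeal : (I : Ideal x (suc r)) (e : Vec (Fin n) k → ℤ) → (∀ s → e s ≢ 0ℤ → IsGen adj l (gen I ∷ s)) →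
    InIdeal I (suc l) (cone (gen I) e)
  cone-InIdeal {x} I e e-gen (v ∷ s) ≢0 with v ≟ gen I
  ... | no  _    = ⊥-elim (≢0 refl)
  ... | yes refl with distinct , length ← e-gen s (*-≢0ʳ 1ℤ (e s) ≢0) =
    ((x≢y , distinct) , trans (len-∷ adj d dist≡d x (gen I) s) (cong₂ _+_ (gen-adjacent I) length)) , gen-∋ I
    where
    x≢y : x ≢ gen I
    x≢y x≡y = case trans (sym (gen-adjacent I)) (trans (cong (d x) (sym x≡y)) (d-refl x)) of λ ()

  module Step (I : Ideal x (suc r)) (f : Vec (Fin n) (suc m) → ℤ) (f∈ : InIdeal I (suc l) f) (f-cycle : Cycle x f) where

    y = gen I

    -- `y` itself is left out, because putting `y` in front of a tuple that starts with `y` would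
    -- repeat an entry.
    isNew : Fin n → Bool
    isNew z = contains I z ∧ not (contains (rest I) z) ∧ not (z == y)

    fNew : Vec (Fin n) (suc m) → ℤ
    fNew (z ∷ t) = ⟦ isNew z ⟧ * f (z ∷ t)

    isNew-≢0 : ∀ z → ⟦ isNew z ⟧ ≢ 0ℤ → contains I z ≡ true × contains (rest I) z ≡ false × z ≢ y
    isNew-≢0 z ≢0 with contains I z | contains (rest I) z | z ≟ y
    ... | true  | false | no z≢y = refl , refl , z≢y
    ... | true  | false | yes _  = ⊥-elim (≢0 refl)
    ... | true  | true  | _      = ⊥-elim (≢0 refl)
    ... | false | _     | _      = ⊥-elim (≢0 refl)

    -- `y` is adjacent to `x` and on a geodesic from `x` to the new `z`, so starting at `y` instead
    -- of `x` shortens the tuple by exactly one.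
    fNew-gen : ∀ s → fNew s ≢ 0ℤ → IsGen adj l (y ∷ s)
    fNew-gen (z ∷ t) ≢0
      with z∈I , z∉R , z≢y ← isNew-≢0 z (*-≢0ˡ ⟦ isNew z ⟧ _ ≢0)
      with ((_ , distinct) , length) , _ ← f∈ (z ∷ t) (*-≢0ʳ ⟦ isNew z ⟧ _ ≢0) =
      (z≢y ∘ sym , distinct) , ℕ.suc-injective (begin
        suc (len adj (y ∷ z ∷ t))           ≡⟨ cong suc (len-∷ adj d dist≡d y z t) ⟩
        1 + d y z + len adj (z ∷ t)         ≡⟨ cong (λ p → p + d y z + len adj (z ∷ t)) (sym (gen-adjacent I)) ⟩
        d x y + d y z + len adj (z ∷ t)     ≡⟨ cong (_+ len adj (z ∷ t)) (new-geodesic I z∈I z∉R) ⟩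
        d x z + len adj (z ∷ t)             ≡⟨ sym (len-∷ adj d dist≡d x z t) ⟩
        len adj (x ∷ z ∷ t)                 ≡⟨ length ⟩
        suc l                               ∎)

    -- Inserting y in front of the new z makes f homologous to f₁, which has no new z other than y itself.
    u = cone y fNew

    u∈ : InIdeal I (suc l) u
    u∈ = cone-InIdeal I fNew fNew-gen

    f₁ : Vec (Fin n) (suc m) → ℤ
    f₁ t = f t +ℤ D x u t

    f₁∈ : InIdeal I (suc l) f₁
    f₁∈ = +-InIdeal I f (D x u) f∈ (D-InIdeal I u u∈)

    f₁-cycle : Cycle x f₁
    f₁-cycle = absorb-cycle f u f-cycle

    D-cone-≢ : ∀ (e : Vec (Fin n) (suc m) → ℤ) {b} t → b ≢ y → D x (cone y e) (b ∷ t) ≡ - (δ x y b * e (b ∷ t))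
    D-cone-≢ e {b} t b≢y = begin
      D x (cone y e) (b ∷ t)                                   ≡⟨ D-cone x y e b t ⟩
      - (δ x y b * e (b ∷ t) +ℤ ⟦ b == y ⟧ * D b e t)          ≡⟨ cong (λ p → - (δ x y b * e (b ∷ t) +ℤ p * D b e t)) (==-≢ b≢y) ⟩
      - (δ x y b * e (b ∷ t) +ℤ 0ℤ)                            ≡⟨ cong -_ (ℤ.+-identityʳ (δ x y b * e (b ∷ t))) ⟩
      - (δ x y b * e (b ∷ t))                                  ∎

    -- Deleting the inserted `y` is a nonzero face, since `y` is on a geodesic from `x` to `b`; it
    -- contributes minus the value of `f` and cancels it.
    f₁-new : ∀ {b} t → contains I b ≡ true → contains (rest I) b ≡ false → b ≢ y → f₁ (b ∷ t) ≡ 0ℤ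
    f₁-new {b} t b∈I b∉R b≢y = begin
      f (b ∷ t) +ℤ D x u (b ∷ t)                             ≡⟨ cong (f (b ∷ t) +ℤ_) (D-cone-≢ fNew t b≢y) ⟩
      f (b ∷ t) +ℤ - (δ x y b * (⟦ isNew b ⟧ * f (b ∷ t)))   ≡⟨ cong₂ (λ p q → f (b ∷ t) +ℤ - (p * (q * f (b ∷ t))))
                                                                   (⟦≡ᵇ⟧-true (new-geodesic I b∈I b∉R)) b-new ⟩
      f (b ∷ t) +ℤ - (1ℤ * (1ℤ * f (b ∷ t)))                 ≡⟨ cancel (f (b ∷ t)) ⟩
      0ℤ                                                     ∎
      where
      cancel : ∀ p → p +ℤ - (1ℤ * (1ℤ * p)) ≡ 0ℤ
      cancel = solve-∀
      b-new : ⟦ isNew b ⟧ ≡ 1ℤ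
      b-new = cong ⟦_⟧ (cong₂ _∧_ b∈I (cong₂ _∧_ (cong not b∉R) (cong not (dec-false (b ≟ y) b≢y))))

    f₁-rest : ∀ {b} t → f₁ (b ∷ t) ≢ 0ℤ → b ≢ y → contains (rest I) b ≡ true
    f₁-rest {b} t ≢0 b≢y with contains (rest I) b ≟ᵇ true
    ... | yes b∈R = b∈R
    ... | no  b∉R = ⊥-elim (≢0 (f₁-new t (proj₂ (f₁∈ (b ∷ t) ≢0)) (¬-not b∉R) b≢y))

    g : Vec (Fin n) m → ℤ
    g t = f₁ (y ∷ t)

    g-gen : ∀ t → g t ≢ 0ℤ → IsGen adj l (y ∷ t)
    g-gen t ≢0 with ((_ , distinct) , length) , _ ← f₁∈ (y ∷ t) ≢0 =
      distinct , ℕ.suc-injective (trans (cong (_+ len adj (y ∷ t)) (sym (gen-adjacent I)))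
                   (trans (sym (len-∷ adj d dist≡d x y t)) length))

  -- At a tuple (x , z , …) with z ∉ rest I, the only faces of f₁ that contribute to ∂ f₁ = 0 come from (x , y , z , …)
  -- and from tuples (x , z , …); z = y shows that g is a cycle, the other z that g lives in colon I.
  module Colon (I : Ideal x (suc r)) (f : Vec (Fin n) (suc (suc m)) → ℤ) (f∈ : InIdeal I (suc l) f) (f-cycle : Cycle x f) where
    open Step I f f∈ f-cycle

    -- Apart from `y`, the heads in the support of `f₁` lie in `rest I`, and prolonging a geodesic
    -- from `x` does not leave `rest I`.
    δ-rest : ∀ {v z} t → contains (rest I) z ≡ false → v ≢ y → δ x v z * f₁ (v ∷ z ∷ t) ≡ 0ℤ
    δ-rest {v} {z} t z∉R v≢y = ≡0-stable λ ≢0 → case trans (sym z∉R)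
      (closed (rest I) (f₁-rest (z ∷ t) (*-≢0ʳ (δ x v z) _ ≢0) v≢y) (⟦≡ᵇ⟧-≢0 _ _ (*-≢0ˡ (δ x v z) _ ≢0))) of λ ()

    sum-rest : ∀ {z} t → contains (rest I) z ≡ false → sum (λ v → δ x v z * f₁ (v ∷ z ∷ t)) ≡ δ x y z * g (z ∷ t)
    sum-rest {z} t z∉R = sum-single y (λ v → δ x v z * f₁ (v ∷ z ∷ t)) (λ v → δ-rest t z∉R)

    g-y : ∀ t → g (y ∷ t) ≡ 0ℤ
    g-y t = ≡0-stable λ ≢0 → proj₁ (proj₁ (g-gen (y ∷ t) ≢0)) refl

    g-cycle : ∀ t → D y g t ≡ 0ℤ
    g-cycle t = begin
      D y g t                                   ≡⟨ isolate (δ x y y * g (y ∷ t)) (D y g t) ⟩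
      - (δ x y y * g (y ∷ t)) +ℤ - - (δ x y y * g (y ∷ t) +ℤ D y g t)
        -- The cycle condition at `y ∷ t` leaves `D y g t` and one multiple of `g (y ∷ t)`, which
        -- vanishes because that tuple repeats `y`.
        ≡⟨ cong₂ (λ p q → - (δ x y y * p) +ℤ - q) (g-y t)
             (trans (cong (λ p → - (p +ℤ D y g t)) (sym (sum-rest t (gen-∌ I)))) (f₁-cycle (y ∷ t))) ⟩
      - (δ x y y * 0ℤ) +ℤ 0ℤ                    ≡⟨ cong (λ p → - p +ℤ 0ℤ) (ℤ.*-zeroʳ (δ x y y)) ⟩
      0ℤ                                        ∎
      where
      isolate : ∀ p q → q ≡ - p +ℤ - - (p +ℤ q)
      isolate = solve-∀

    g-new : ∀ {z} t → contains I z ≡ true → contains (rest I) z ≡ false → z ≢ y → g (z ∷ t) ≡ 0ℤ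
    g-new {z} t z∈I z∉R z≢y = begin
      g (z ∷ t)                                                  ≡⟨ isolate (g (z ∷ t)) (D z (f₁ ∘ (z ∷_)) t) ⟩
      - - (1ℤ * g (z ∷ t) +ℤ D z (f₁ ∘ (z ∷_)) t) +ℤ - D z (f₁ ∘ (z ∷_)) t
        ≡⟨ cong₂ (λ p q → - p +ℤ - q)
             (trans (cong (λ p → - (p +ℤ D z (f₁ ∘ (z ∷_)) t)) (trans (cong (_* g (z ∷ t)) (sym (⟦≡ᵇ⟧-true (new-geodesic I z∈I z∉R)))) (sym (sum-rest t z∉R))))
                    (f₁-cycle (z ∷ t)))
             -- Faces that delete an entry after `z` come from tuples with the new head `z`, where
             -- `f₁` is already zero.
             (D-zero z (λ s → f₁-new s z∈I z∉R z≢y) t) ⟩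
      0ℤ ∎
      where
      isolate : ∀ p q → p ≡ - - (1ℤ * p +ℤ q) +ℤ - q
      isolate = solve-∀

    g-colon : ∀ z t → g (z ∷ t) ≢ 0ℤ → contains (colon I) z ≡ true
    g-colon z t ≢0 with toSum (z ≟ y)
    ... | inj₁ refl = ⊥-elim (≢0 (g-y t))
    ... | inj₂ z≢y with contains I z ≟ᵇ true | contains (rest I) z ≟ᵇ true
    ...   | no  z∉I | _       = colon-∋ I z≢y (inj₁ (¬-not z∉I))
    ...   | yes _   | yes z∈R = colon-∋ I z≢y (inj₂ z∈R)
    ...   | yes z∈I | no  z∉R = ⊥-elim (≢0 (g-new t z∈I (¬-not z∉R) z≢y))

  g-InIdeal : (I : Ideal x (suc r)) (f : Vec (Fin n) (suc m) → ℤ) (f∈ : InIdeal I (suc l) f) (f-cycle : Cycle x f) →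
    InIdeal (colon I) l (Step.g I f f∈ f-cycle)
  g-InIdeal I f f∈ f-cycle []      ≢0 = Step.g-gen I f f∈ f-cycle [] ≢0 , tt
  g-InIdeal I f f∈ f-cycle (z ∷ t) ≢0 = Step.g-gen I f f∈ f-cycle (z ∷ t) ≢0 , Colon.g-colon I f f∈ f-cycle z t ≢0

  g-Cycle : (I : Ideal x (suc r)) (f : Vec (Fin n) (suc m) → ℤ) (f∈ : InIdeal I (suc l) f) (f-cycle : Cycle x f) →
    Cycle (gen I) (Step.g I f f∈ f-cycle)
  g-Cycle {m = zero}  I f f∈ f-cycle = tt
  g-Cycle {m = suc m} I f f∈ f-cycle = Colon.g-cycle I f f∈ f-cycle

  -- Let `e` fill the part `g` of `f₁` at `y`. Adding the boundary of the cone on `e` cancels `g`,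
  -- and at any other head it adds only multiples of values of `e`. As `e` lives over `colon I`,
  -- these lie over `rest I`, so the new cycle `f₂` can be filled there.
  step : (I : Ideal x (suc r)) → Acyclic (colon I) m l → Acyclic (rest I) (suc m) (suc l) → Acyclic I (suc m) (suc l)
  step {x} {m = m} {l} I acyclic-colon acyclic-rest f f∈ f-cycle
    with e , e∈ , De ← acyclic-colon (Step.g I f f∈ f-cycle) (g-InIdeal I f f∈ f-cycle) (g-Cycle I f f∈ f-cycle) =
    absorb-boundary I f u u∈ (absorb-boundary I f₁ w w∈ (enlarge (acyclic-rest f₂ f₂∈rest (absorb-cycle f₁ w f₁-cycle))))
    where
    open Step I f f∈ f-cycle

    w = cone y e

    w∈ : InIdeal I (suc l) w
    w∈ = cone-InIdeal I e (λ s ≢0 → proj₁ (e∈ s ≢0))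

    f₂ : Vec (Fin n) (suc m) → ℤ
    f₂ t = f₁ t +ℤ D x w t

    f₂-y : ∀ t → f₂ (y ∷ t) ≡ 0ℤ
    f₂-y t = begin
      g t +ℤ D x w (y ∷ t)                                            ≡⟨ cong (g t +ℤ_) (D-cone x y e y t) ⟩
      g t +ℤ - (δ x y y * e (y ∷ t) +ℤ ⟦ y == y ⟧ * D y e t)          ≡⟨ cong₂ (λ p q → g t +ℤ - (δ x y y * p +ℤ q)) e-y
                                                                          (cong₂ _*_ (==-refl y) (De t)) ⟩
      g t +ℤ - (δ x y y * 0ℤ +ℤ 1ℤ * g t)                             ≡⟨ cancel (g t) (δ x y y) ⟩
      0ℤ                                                              ∎
      where
      e-y : e (y ∷ t) ≡ 0ℤ
      e-y = ≡0-stable λ ≢0 → proj₁ (proj₁ (proj₁ (e∈ (y ∷ t) ≢0))) refl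
      cancel : ∀ p q → p +ℤ - (q * 0ℤ +ℤ 1ℤ * p) ≡ 0ℤ
      cancel = solve-∀

    f₂∈ : InIdeal I (suc l) f₂
    f₂∈ = +-InIdeal I f₁ (D x w) f₁∈ (D-InIdeal I w w∈)

    f₂-head : ∀ b t → f₂ (b ∷ t) ≢ 0ℤ → contains (rest I) b ≡ true
    f₂-head b t ≢0 with toSum (b ≟ y)
    ... | inj₁ refl = ⊥-elim (≢0 (f₂-y t))
    ... | inj₂ b≢y with +-≢0 (f₁ (b ∷ t)) (D x w (b ∷ t)) ≢0
    ...   | inj₁ f₁≢0 = f₁-rest t f₁≢0 b≢y
    -- A contribution of the cone means that `y` is on a geodesic from `x` to `b`, so `b` is in `I`.
    -- Since `b` is also in `colon I`, it cannot be new.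
    ...   | inj₂ Dw≢0 = colon-∌-new I (proj₂ (e∈ (b ∷ t) (*-≢0ʳ (δ x y b) _ δe≢0)))
                          (closed I (gen-∋ I) (⟦≡ᵇ⟧-≢0 _ _ (*-≢0ˡ (δ x y b) _ δe≢0)))
      where
      δe≢0 : δ x y b * e (b ∷ t) ≢ 0ℤ
      δe≢0 = neg-≢0 _ (subst (_≢ 0ℤ) (D-cone-≢ e t b≢y) Dw≢0)

    f₂∈rest : InIdeal (rest I) (suc l) f₂
    f₂∈rest (b ∷ t) ≢0 = proj₁ (f₂∈ (b ∷ t) ≢0) , f₂-head b t ≢0

    enlarge : Boundary (rest I) (suc l) f₂ → Boundary I (suc l) f₂
    enlarge (h , h∈ , Dh) = h , (λ { (z ∷ t) ≢0 → proj₁ (h∈ (z ∷ t) ≢0) , rest-⊆ I (proj₂ (h∈ (z ∷ t) ≢0)) }) , Dh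

  -- The recursion either lowers the rank at the same `k` and `l`, or lowers both `k` and `l` by one
  -- with an arbitrary rank, so `k ≢ l` persists. In the base cases no generator exists: `(x)` has
  -- length 0, a tuple with at least two entries has positive length, and an ideal of rank 0 is
  -- empty.
  acyclic : ∀ k l → k ≢ l → (I : Ideal x r) → Acyclic I k l
  acyclic zero l 0≢l I f f∈ _ = zero-boundary I f λ { [] → ≡0-stable λ ≢0 → 0≢l (proj₂ (proj₁ (f∈ [] ≢0))) }
  acyclic {x} (suc k) zero _ I f f∈ _ = zero-boundary I f λ { (z ∷ t) → ≡0-stable λ ≢0 →
    let (x≢z , _) , length = proj₁ (f∈ (z ∷ t) ≢0)
    in x≢z (d≡0 (ℕ.m+n≡0⇒m≡0 (d x z) (trans (sym (len-∷ adj d dist≡d x z t)) length))) }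
  acyclic {r = zero} (suc k) (suc l) _ I f f∈ _ = zero-boundary I f λ { (z ∷ t) → ≡0-stable λ ≢0 →
    case trans (sym (empty I z)) (proj₂ (f∈ (z ∷ t) ≢0)) of λ () }
  acyclic {r = suc r} (suc k) (suc l) k≢l I =
    step I (acyclic k l (k≢l ∘ cong suc) (colon I)) (acyclic (suc k) (suc l) k≢l (rest I))

  -- The differential preserves the first entry, so the complex splits over it. The piece at `a`
  -- consists of chains over `maximal a`, and the fillings of the pieces are glued.
  diagonal : Diagonal adj
  diagonal k l k≢l c c-gen c-cycle = b , b-gen , λ { (a ∷ t) → trans (∂≡D adj d dist≡d b a t) (proj₂ (proj₂ (filling a)) t) }
    where
    distinct-head : ∀ a (t : Vec (Fin n) k) → ConsecDistinct (a ∷ t) → Head∈ (maximal a) t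
    distinct-head a []      _          = tt
    distinct-head a (z ∷ t) (a≢z , _)  = maximal-∋ a≢z

    cycle : ∀ {k} (c : Chain n k) → IsCycle adj c → ∀ a → Cycle a (c ∘ (a ∷_))
    cycle {zero}  c _       a = tt
    cycle {suc k} c c-cycle a t = trans (sym (∂≡D adj d dist≡d c a t)) (c-cycle (a ∷ t))

    filling : ∀ a → Boundary (maximal a) l (c ∘ (a ∷_))
    filling a = acyclic k l k≢l (maximal a) (c ∘ (a ∷_))
      (λ t ≢0 → c-gen (a ∷ t) ≢0 , distinct-head a t (proj₁ (c-gen (a ∷ t) ≢0))) (cycle c c-cycle a)

    b : Chain n (suc k)
    b (a ∷ s) = proj₁ (filling a) s

    b-gen : Supported adj l b
    b-gen (a ∷ s) ≢0 = proj₁ (proj₁ (proj₂ (filling a)) s ≢0)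

-- Distances in the icosahedral graph.

-- A table, so that the exhaustive checks below look distances up instead of repeating the walk
-- search in `dist`.
icoDist : Fin 12 → Fin 12 → ℕ
icoDist x y = lookup (lookup distances x) y
  where
  distances : Vec (Vec ℕ 12) 12
  distances =
    (0 ∷ 1 ∷ 1 ∷ 1 ∷ 1 ∷ 1 ∷ 2 ∷ 2 ∷ 2 ∷ 2 ∷ 2 ∷ 3 ∷ []) ∷
    (1 ∷ 0 ∷ 1 ∷ 2 ∷ 2 ∷ 1 ∷ 1 ∷ 2 ∷ 3 ∷ 2 ∷ 1 ∷ 2 ∷ []) ∷
    (1 ∷ 1 ∷ 0 ∷ 1 ∷ 2 ∷ 2 ∷ 1 ∷ 1 ∷ 2 ∷ 3 ∷ 2 ∷ 2 ∷ []) ∷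
    (1 ∷ 2 ∷ 1 ∷ 0 ∷ 1 ∷ 2 ∷ 2 ∷ 1 ∷ 1 ∷ 2 ∷ 3 ∷ 2 ∷ []) ∷
    (1 ∷ 2 ∷ 2 ∷ 1 ∷ 0 ∷ 1 ∷ 3 ∷ 2 ∷ 1 ∷ 1 ∷ 2 ∷ 2 ∷ []) ∷
    (1 ∷ 1 ∷ 2 ∷ 2 ∷ 1 ∷ 0 ∷ 2 ∷ 3 ∷ 2 ∷ 1 ∷ 1 ∷ 2 ∷ []) ∷
    (2 ∷ 1 ∷ 1 ∷ 2 ∷ 3 ∷ 2 ∷ 0 ∷ 1 ∷ 2 ∷ 2 ∷ 1 ∷ 1 ∷ []) ∷
    (2 ∷ 2 ∷ 1 ∷ 1 ∷ 2 ∷ 3 ∷ 1 ∷ 0 ∷ 1 ∷ 2 ∷ 2 ∷ 1 ∷ []) ∷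
    (2 ∷ 3 ∷ 2 ∷ 1 ∷ 1 ∷ 2 ∷ 2 ∷ 1 ∷ 0 ∷ 1 ∷ 2 ∷ 1 ∷ []) ∷
    (2 ∷ 2 ∷ 3 ∷ 2 ∷ 1 ∷ 1 ∷ 2 ∷ 2 ∷ 1 ∷ 0 ∷ 1 ∷ 1 ∷ []) ∷
    (2 ∷ 1 ∷ 2 ∷ 3 ∷ 2 ∷ 1 ∷ 1 ∷ 2 ∷ 2 ∷ 1 ∷ 0 ∷ 1 ∷ []) ∷
    (3 ∷ 2 ∷ 2 ∷ 2 ∷ 2 ∷ 2 ∷ 1 ∷ 1 ∷ 1 ∷ 1 ∷ 1 ∷ 0 ∷ []) ∷ []

dist≡icoDist : ∀ x y → dist icosahedron x y ≡ icoDist x y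
dist≡icoDist = from-yes (all? λ x → all? λ y → dist icosahedron x y ℕ.≟ icoDist x y)

icoDist-refl : ∀ x → icoDist x x ≡ 0
icoDist-refl = from-yes (all? λ x → icoDist x x ℕ.≟ 0)

icoDist≡0 : ∀ x y → icoDist x y ≡ 0 → x ≡ y
icoDist≡0 = from-yes (all? λ x → all? λ y → icoDist x y ℕ.≟ 0 →-dec x ≟ y)

triangle : ∀ x y z → icoDist x z ≤ icoDist x y + icoDist y z
triangle = from-yes (all? λ x → all? λ y → all? λ z → icoDist x z ℕ.≤? icoDist x y + icoDist y z)

-- Arcs of neighbours as a Koszul filtration.

-- The neighbours of x in cyclic order, with the same orientation at every x.
neighbour : Fin 12 → Fin 5 → Fin 12
neighbour x i = lookup (lookup neighbours x) i
  where
  neighbours : Vec (Vec (Fin 12) 5) 12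
  neighbours =
    (# 1 ∷ # 2  ∷ # 3  ∷ # 4  ∷ # 5  ∷ []) ∷
    (# 2 ∷ # 0  ∷ # 5  ∷ # 10 ∷ # 6  ∷ []) ∷
    (# 3 ∷ # 0  ∷ # 1  ∷ # 6  ∷ # 7  ∷ []) ∷
    (# 4 ∷ # 0  ∷ # 2  ∷ # 7  ∷ # 8  ∷ []) ∷
    (# 5 ∷ # 0  ∷ # 3  ∷ # 8  ∷ # 9  ∷ []) ∷
    (# 1 ∷ # 0  ∷ # 4  ∷ # 9  ∷ # 10 ∷ []) ∷
    (# 2 ∷ # 1  ∷ # 10 ∷ # 11 ∷ # 7  ∷ []) ∷
    (# 3 ∷ # 2  ∷ # 6  ∷ # 11 ∷ # 8  ∷ []) ∷
    (# 4 ∷ # 3  ∷ # 7  ∷ # 11 ∷ # 9  ∷ []) ∷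
    (# 5 ∷ # 4  ∷ # 8  ∷ # 11 ∷ # 10 ∷ []) ∷
    (# 6 ∷ # 1  ∷ # 5  ∷ # 9  ∷ # 11 ∷ []) ∷
    (# 6 ∷ # 10 ∷ # 9  ∷ # 8  ∷ # 7  ∷ []) ∷ []

-- neighbour (neighbour x i) (back x i) ≡ x
back : Fin 12 → Fin 5 → Fin 5
back x i = lookup (lookup positions x) i
  where
  positions : Vec (Vec (Fin 5) 5) 12
  positions =
    (# 1 ∷ # 1 ∷ # 1 ∷ # 1 ∷ # 1 ∷ []) ∷
    (# 2 ∷ # 0 ∷ # 0 ∷ # 1 ∷ # 1 ∷ []) ∷
    (# 2 ∷ # 1 ∷ # 0 ∷ # 0 ∷ # 1 ∷ []) ∷
    (# 2 ∷ # 2 ∷ # 0 ∷ # 0 ∷ # 1 ∷ []) ∷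
    (# 2 ∷ # 3 ∷ # 0 ∷ # 0 ∷ # 1 ∷ []) ∷
    (# 2 ∷ # 4 ∷ # 0 ∷ # 0 ∷ # 2 ∷ []) ∷
    (# 3 ∷ # 4 ∷ # 0 ∷ # 0 ∷ # 2 ∷ []) ∷
    (# 3 ∷ # 4 ∷ # 4 ∷ # 4 ∷ # 2 ∷ []) ∷
    (# 3 ∷ # 4 ∷ # 4 ∷ # 3 ∷ # 2 ∷ []) ∷
    (# 3 ∷ # 4 ∷ # 4 ∷ # 2 ∷ # 3 ∷ []) ∷
    (# 2 ∷ # 3 ∷ # 4 ∷ # 4 ∷ # 1 ∷ []) ∷
    (# 3 ∷ # 4 ∷ # 3 ∷ # 3 ∷ # 3 ∷ []) ∷ []

next prev : Fin 5 → Fin 5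
next = lookup (# 1 ∷ # 2 ∷ # 3 ∷ # 4 ∷ # 0 ∷ [])
prev = lookup (# 4 ∷ # 0 ∷ # 1 ∷ # 2 ∷ # 3 ∷ [])

-- A right ideal generated by basis elements is spanned by basis elements, so a Boolean test on `z`
-- describes it. The generators are the `r` neighbours from position `i` on.
arc : Fin 12 → Fin 5 → ℕ → Fin 12 → Bool
arc x i zero    z = false
arc x i (suc r) z = (icoDist x (neighbour x i) + icoDist (neighbour x i) z ≡ᵇ icoDist x z) ∨ arc x (next i) r z

-- A generator that precedes `z` on a geodesic from `x` also precedes `w`, by `geodesic-assoc`.
arc-closed : ∀ x i r {z w} → arc x i r z ≡ true → icoDist x z + icoDist z w ≡ icoDist x w → arc x i r w ≡ true
arc-closed x i (suc r) {z} {w} z∈ xzw with icoDist x (neighbour x i) + icoDist (neighbour x i) z ℕ.≟ icoDist x z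
... | yes xyz = cong (_∨ arc x (next i) r w) (≡ᵇ-true (proj₁ (Based.geodesic-assoc icoDist triangle {x} {neighbour x i} {z} {w} xyz xzw)))
... | no ¬xyz = trans (cong (_ ∨_) (arc-closed x (next i) r (trans (cong (_∨ arc x (next i) r z) (sym (≡ᵇ-false ¬xyz))) z∈) xzw))
  (∨-zeroʳ _)

-- The annihilator of y = neighbour x i is generated by x, the two common neighbours of x and y, and the neighbours
-- of y that are adjacent to another generator of the arc; the arc around y that they form starts at colonStart.
colonStart : Fin 12 → Fin 5 → ℕ → Fin 5
colonStart x i zero    = prev (back x i)
colonStart x i (suc r) = prev (prev (back x i))

-- The argument counts the generators left beside `y`. With one to three left, only one of the two
-- generators next to `y` in the cyclic order is present and adds one neighbour of `y`; with four
-- left, both are.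
colonSize : ℕ → ℕ
colonSize 0 = 3
colonSize 1 = 4
colonSize 2 = 4
colonSize 3 = 4
colonSize _ = 5

colonSize≤5 : ∀ r → colonSize r ≤ 5
colonSize≤5 0 = from-yes (3 ℕ.≤? 5)
colonSize≤5 1 = from-yes (4 ℕ.≤? 5)
colonSize≤5 2 = from-yes (4 ℕ.≤? 5)
colonSize≤5 3 = from-yes (4 ℕ.≤? 5)
colonSize≤5 (suc (suc (suc (suc r)))) = ℕ.≤-refl

neighbour-adjacent : ∀ x i → icoDist x (neighbour x i) ≡ 1
neighbour-adjacent = from-yes (all? λ x → all? λ i → icoDist x (neighbour x i) ℕ.≟ 1)

arc-full : ∀ x z → x ≢ z → arc x (# 0) 5 z ≡ true
arc-full = from-yes (all? λ x → all? λ z → ¬? (x ≟ z) →-dec arc x (# 0) 5 z ≟ᵇ true)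

-- Neighbours of `x` are all at distance 1, so none is on a geodesic from `x` to another. The bound
-- is strict because five steps from `next i` would come round to position `i` again.
arc-irredundant : ∀ x i {r} → r < 5 → arc x (next i) r (neighbour x i) ≡ false
arc-irredundant = from-yes (all? λ x → all? λ i → ℕ.allUpTo? (λ r → arc x (next i) r (neighbour x i) ≟ᵇ false) 5)

-- The one computation specific to the icosahedron: the annihilator of a generator modulo the
-- remaining arc is again an arc. Stated as an equation of Booleans, it is verified exhaustively and
-- yields both conditions on `colon`.
arc-colon : ∀ x i {r} → r < 5 → ∀ z →
  arc (neighbour x i) (colonStart x i r) (colonSize r) z ≡
  not (z == neighbour x i) ∧ (not (arc x i (suc r) z) ∨ arc x (next i) r z)
arc-colon = from-yes (all? λ x → all? λ i → ℕ.allUpTo? (λ r → all? λ z →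
  arc (neighbour x i) (colonStart x i r) (colonSize r) z ≟ᵇ
  (not (z == neighbour x i) ∧ (not (arc x i (suc r) z) ∨ arc x (next i) r z))) 5)

old-⇒ : ∀ {p q r} → not p ∧ (not q ∨ r) ≡ true → q ≡ true → r ≡ true
old-⇒ {false} eq refl = eq

old-⇐ : ∀ {p q r} → p ≡ false → q ≡ false ⊎ r ≡ true → not p ∧ (not q ∨ r) ≡ true
old-⇐ refl (inj₁ refl)         = refl
old-⇐ {q = q} refl (inj₂ refl) = ∨-zeroʳ (not q)

arcs : KoszulFiltration icoDist
arcs = record
  -- The bound keeps an arc from overlapping itself; for an arc of rank `suc r` it is the `r < 5`
  -- that `arc-irredundant` and `arc-colon` require.
  { Ideal        = λ _ r → Fin 5 × r ≤ 5
  ; contains     = λ {x} {r} (i , _) → arc x i r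
  ; closed       = λ {x} {r} (i , _) → arc-closed x i r
  ; empty        = λ _ _ → refl
  ; maxRank      = 5
  ; maximal      = λ _ → # 0 , ℕ.≤-refl
  ; maximal-∋    = λ {x} {z} → arc-full x z
  ; gen          = λ {x} (i , _) → neighbour x i
  ; rest         = λ (i , r<5) → next i , ℕ.<⇒≤ r<5
  ; colonRank    = λ {_} {r} _ → colonSize r
  ; colon        = λ {x} {r} (i , _) → colonStart x i r , colonSize≤5 r
  ; gen-adjacent = λ {x} (i , _) → neighbour-adjacent x i
  ; gen-∋        = λ {x} {r} (i , _) → cong (_∨ arc x (next i) r (neighbour x i))
                     (≡ᵇ-true (trans (cong (icoDist x (neighbour x i) +_) (icoDist-refl (neighbour x i))) (ℕ.+-identityʳ _)))
  ; gen-∌        = λ {x} (i , r<5) → arc-irredundant x i r<5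
  ; rest-⊆       = λ {x} {r} (i , _) {z} z∈R → trans (cong (_ ∨_) z∈R) (∨-zeroʳ _)
  -- `arc` is a disjunction of the geodesic test for the first generator and membership in the rest,
  -- so outside the rest only the test remains.
  ; new-geodesic = λ {x} {r} (i , _) {z} z∈I z∉R → ℕ.≡ᵇ⇒≡ _ _
                     (subst T (sym (trans (sym (trans (cong (_ ∨_) z∉R) (∨-identityʳ _))) z∈I)) tt)
  ; colon-∌-new  = λ {x} (i , r<5) {z} z∈C → old-⇒ (trans (sym (arc-colon x i r<5 z)) z∈C)
  ; colon-∋      = λ {x} (i , r<5) {z} z≢y old → trans (arc-colon x i r<5 z) (old-⇐ (dec-false (z ≟ _) z≢y) old)
  }

theorem4p5 : Diagonal icosahedron
theorem4p5 = Filtered.diagonal icosahedron icoDist dist≡icoDist icoDist-refl (icoDist≡0 _ _) triangle arcs
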